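{- Let $k>s\ge 1$ be integers and let $n$ be an integer with $n>2k-s$. Let $\mathcal C=\{C\in\binom{[n]}{k}: |C\cap[k]|\ge s\}$. Then $$\max_{\mathcal A,\mathcal B}\bigl(|\mathcal A|+|\mathcal B|\bigr)=|\mathcal C|+1,$$ where the maximum is taken over all pairs of non-empty $s$-cross-intersecting families $\mathcal A,\mathcal B\subset\binom{[n]}{k}$.
   Context: For a positive integer $m$, $[m]=\{1,\ldots,m\}$, and $\binom{[n]}{k}$ denotes the collection of all $k$-element subsets of $[n]$. Two families $\mathcal A,\mathcal B$ of subsets of $[n]$ are called $s$-cross-intersecting if $|A\cap B|\ge s$ for all $A\in\mathcal A$ and $B\in\mathcal B$. -}

module Defs where

open import Data.Bool.Base using (true; false)
open import Data.Empty using (⊥)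
open import Data.Fin.Base using (toℕ)
open import Data.Fin.Subset using (Subset; ∣_∣; _∩_; inside; outside)
open import Data.List.Base using (List; []; _∷_; _++_; map; filter; length)
open import Data.List.Membership.Propositional using (_∈_)
open import Data.List.Membership.Propositional.Properties using (∈-map⁺; ∈-map⁻; ∈-++⁺ˡ; ∈-++⁺ʳ; ∈-filter⁺; ∈-filter⁻)
open import Data.List.Relation.Unary.All using ([])
open import Data.List.Relation.Unary.AllPairs using ([]; _∷_)
open import Data.List.Relation.Unary.Any using (here)
open import Data.List.Relation.Unary.Unique.Propositional using (Unique)
open import Data.List.Relation.Unary.Unique.Propositional.Properties using (map⁺; ++⁺; filter⁺)
open import Data.Nat.Base using (ℕ; zero; suc; _≤_)
open import Data.Nat.Properties using (_≟_; _≤?_; _<?_)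
open import Data.Product.Base using (_×_; _,_; proj₂; ∃-syntax)
open import Data.Vec.Base using ([]; _∷_; tabulate)
open import Data.Vec.Properties using (∷-injectiveʳ)
open import Function.Bundles using (_⇔_; mk⇔)
open import Relation.Binary.PropositionalEquality using (_≡_; refl)
open import Relation.Nullary.Decidable using (Dec; does; _×-dec_)

-- A family of subsets of [n], as a list without repetitions, so that its
-- cardinality is the length of the list.  The element i of [n] = {1,…,n} is
-- represented by the element of Fin n whose toℕ is i - 1.
record Family (n : ℕ) : Set where
  field
    members : List (Subset n)
    unique  : Unique members

open Family public

infix 4 _∈ᶠ_

_∈ᶠ_ : ∀ {n} → Subset n → Family n → Set
A ∈ᶠ 𝒜 = A ∈ members 𝒜

card : ∀ {n} → Family n → ℕ
card 𝒜 = length (members 𝒜)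

NonEmpty : ∀ {n} → Family n → Set
NonEmpty 𝒜 = ∃[ A ] A ∈ᶠ 𝒜

Uniform : ∀ {n} → ℕ → Family n → Set
Uniform k 𝒜 = ∀ A → A ∈ᶠ 𝒜 → ∣ A ∣ ≡ k

CrossIntersecting : ∀ {n} → ℕ → Family n → Family n → Set
CrossIntersecting s 𝒜 ℬ = ∀ A B → A ∈ᶠ 𝒜 → B ∈ᶠ ℬ → s ≤ ∣ A ∩ B ∣

IsMaximum : (ℕ → Set) → ℕ → Set
IsMaximum P m = P m × (∀ v → P v → v ≤ m)

-- The set [k] as a subset of [n].
initial : ∀ {n} → ℕ → Subset n
initial k = tabulate (λ i → does (toℕ i <? k))

subsets : ∀ n → List (Subset n)
subsets zero    = [] ∷ []
subsets (suc n) = map (outside ∷_) (subsets n) ++ map (inside ∷_) (subsets n)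

∈-subsets : ∀ {n} (A : Subset n) → A ∈ subsets n
∈-subsets []          = here refl
∈-subsets (false ∷ A) = ∈-++⁺ˡ (∈-map⁺ (outside ∷_) (∈-subsets A))
∈-subsets (true ∷ A)  = ∈-++⁺ʳ (map (outside ∷_) (subsets _)) (∈-map⁺ (inside ∷_) (∈-subsets A))

subsets-unique : ∀ n → Unique (subsets n)
subsets-unique zero    = [] ∷ []
subsets-unique (suc n) = ++⁺ (map⁺ ∷-injectiveʳ (subsets-unique n)) (map⁺ ∷-injectiveʳ (subsets-unique n)) disjoint
  where
  disjoint : ∀ {A} → A ∈ map (outside ∷_) (subsets n) × A ∈ map (inside ∷_) (subsets n) → ⊥
  disjoint (p , q) with ∈-map⁻ (outside ∷_) p | ∈-map⁻ (inside ∷_) q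
  ... | _ , _ , refl | _ , _ , ()

InC : ∀ {n} → ℕ → ℕ → Subset n → Set
InC k s C = ∣ C ∣ ≡ k × s ≤ ∣ C ∩ initial k ∣

inC? : ∀ {n} k s (C : Subset n) → Dec (InC k s C)
inC? k s C = (∣ C ∣ ≟ k) ×-dec (s ≤? ∣ C ∩ initial k ∣)

familyC : ∀ n → ℕ → ℕ → Family n
familyC n k s = record
  { members = filter (inC? k s) (subsets n)
  ; unique  = filter⁺ (inC? k s) (subsets-unique n)
  }

∈-familyC : ∀ {n} k s (C : Subset n) → C ∈ᶠ familyC n k s ⇔ InC k s C
∈-familyC k s C = mk⇔
  (λ p → proj₂ (∈-filter⁻ (inC? k s) {xs = subsets _} p))
  (∈-filter⁺ (inC? k s) (∈-subsets C))

{-# OPTIONS --safe #-}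

-- Induction on n, for all k at once.  Compressing both families from the point 0
-- towards every other point x keeps them uniform, s-cross-intersecting and of the same
-- size.  Afterwards the members avoiding 0 form s-cross-intersecting families on n - 1
-- points, and if n > 2k - s so do the links of 0, as (k-1)-sets; adding the two bounds
-- gives the claim, unless one of the links is empty, when the other one is bounded by
-- intersecting it with a single set.  The induction stops at n = 2k - s + 1, where
-- taking complements replaces (k, s) by (k - s + 1, 1).  This lands either in the
-- inductive range again or at n = 2k, s = 1, where at most one set of each
-- complementary pair can be used (A in the first family, its complement in the second).
module Submission where

open import Defs
open import Data.Bool.Base using (true; false; not; if_then_else_)
open import Data.Bool.Properties using () renaming (_≟_ to _≟ᵇ_)
open import Data.Empty using (⊥-elim)
open import Data.Fin.Base using (Fin; zero; suc)
open import Data.Fin.Subset using (Subset; ∣_∣; _∩_; ∁; inside; outside; _∈_; _∉_)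
open import Data.Fin.Subset.Properties using (_∈?_; ∩-comm; ∩-idem; ∩-inverseʳ; ∣⊥∣≡0; ∣∁p∣≡n∸∣p∣; ∣p∩q∣≤∣p∣; drop-there)
open import Data.List.Base using (List; []; _∷_; map; filter; foldr; length; allFin)
open import Data.List.Membership.Propositional using () renaming (_∈_ to _∈ˡ_)
open import Data.List.Membership.Propositional.Properties using (∈-allFin)
open import Data.List.Properties using (filter-++; length-++)
import Data.List.Relation.Unary.All as All
open import Data.List.Relation.Unary.AllPairs using ([]; _∷_)
open import Data.List.Relation.Unary.Any using (any?) renaming (here to hereˡ; there to thereˡ)
open import Data.List.Relation.Unary.Unique.Propositional using (Unique)
open import Data.Nat.Base using (ℕ; zero; suc; _+_; _*_; _∸_; _≤_; _<_; z≤n; s≤s; s≤s⁻¹)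
open import Data.Nat.Properties
open import Data.Nat.Tactic.RingSolver using (solve-∀)
open import Data.Product.Base using (_×_; _,_; proj₁; proj₂; ∃-syntax)
open import Data.Sum.Base using (_⊎_; inj₁; inj₂; [_,_]′)
open import Data.Vec.Base using ([]; _∷_; _[_]≔_; _[_]%=_; here; there)
open import Data.Vec.Properties using (∷-injectiveʳ; ≡-dec)
open import Function.Base using (_∘_; id)
open import Function.Bundles using (Equivalence)
open import Level using (0ℓ)
open import Relation.Binary.Definitions using (DecidableEquality)
open import Relation.Binary.PropositionalEquality using (_≡_; refl; sym; trans; cong; cong₂; subst)
open import Relation.Nullary using (¬_; Dec; yes; no; does; contradiction)
open import Relation.Nullary.Decidable using (_×-dec_; _⊎-dec_; ¬?)
open import Relation.Unary using (Pred; Decidable; _⊆_)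

private
  variable
    n s k : ℕ
    P Q R : Pred (Subset n) 0ℓ

-- Intersection sizes under complement, deletion and insertion.

-- The first term is n minus the size of the union; moving everything to sums avoids truncated
-- subtraction.
inclusion-exclusion : (A B : Subset n) → ∣ ∁ A ∩ ∁ B ∣ + (∣ A ∣ + ∣ B ∣) ≡ n + ∣ A ∩ B ∣
inclusion-exclusion [] [] = refl
inclusion-exclusion {suc n} (true ∷ A) (true ∷ B) = trans (l (∣ ∁ A ∩ ∁ B ∣) (∣ A ∣) (∣ B ∣))
  (trans (cong (2 +_) (inclusion-exclusion A B)) (cong suc (sym (+-suc n _))))
  where
  l : ∀ x y z → x + (suc y + suc z) ≡ suc (suc (x + (y + z)))
  l = solve-∀
inclusion-exclusion (true ∷ A) (false ∷ B) = trans (+-suc _ _) (cong suc (inclusion-exclusion A B))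
inclusion-exclusion (false ∷ A) (true ∷ B) = trans (l (∣ ∁ A ∩ ∁ B ∣) (∣ A ∣) (∣ B ∣))
  (cong suc (inclusion-exclusion A B))
  where
  l : ∀ x y z → x + (y + suc z) ≡ suc (x + (y + z))
  l = solve-∀
inclusion-exclusion (false ∷ A) (false ∷ B) = cong suc (inclusion-exclusion A B)

0<∣p∣⇒nonempty : (A : Subset n) → 0 < ∣ A ∣ → ∃[ x ] x ∈ A
0<∣p∣⇒nonempty (true ∷ A) _ = zero , here
0<∣p∣⇒nonempty (false ∷ A) 0<∣A∣ = let x , x∈A = 0<∣p∣⇒nonempty A 0<∣A∣ in suc x , there x∈A

-- By inclusion-exclusion the hypothesis says that the union of `A` and `B` has fewer than n points.
common-nonmember : (A B : Subset n) → ∣ A ∣ + ∣ B ∣ < n + ∣ A ∩ B ∣ → ∃[ x ] x ∉ A × x ∉ B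
common-nonmember A B lt = let x , x∈ = 0<∣p∣⇒nonempty (∁ A ∩ ∁ B) pos in x , outsideBoth A B x∈
  where
  pos : 0 < ∣ ∁ A ∩ ∁ B ∣
  pos = +-cancelʳ-< (∣ A ∣ + ∣ B ∣) 0 _ (≤-trans lt (≤-reflexive (sym (inclusion-exclusion A B))))

  outsideBoth : ∀ {n} (A B : Subset n) {x} → x ∈ ∁ A ∩ ∁ B → x ∉ A × x ∉ B
  outsideBoth (false ∷ A) (false ∷ B) here = (λ ()) , (λ ())
  outsideBoth (_ ∷ A) (_ ∷ B) (there x∈) = let x∉A , x∉B = outsideBoth A B x∈ in
    (x∉A ∘ drop-there) , (x∉B ∘ drop-there)

-- The two hypotheses say that `X` and `B` together cover all points and that they are disjoint.
∁-unique : (X B : Subset n) → ∣ ∁ X ∩ ∁ B ∣ ≡ 0 → ∣ X ∩ B ∣ ≡ 0 → X ≡ ∁ B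
∁-unique [] [] _ _ = refl
∁-unique (true ∷ X) (false ∷ B) p q = cong (true ∷_) (∁-unique X B p q)
∁-unique (false ∷ X) (true ∷ B) p q = cong (false ∷_) (∁-unique X B p q)

∣p∩∁p∣≡0 : (A : Subset n) → ∣ A ∩ ∁ A ∣ ≡ 0
∣p∩∁p∣≡0 {n} A = trans (cong ∣_∣ (∩-inverseʳ A)) (∣⊥∣≡0 n)

∣∁p∣≡ : ∀ {k e n} (A : Subset n) → ∣ A ∣ ≡ k → k + e ≡ n → ∣ ∁ A ∣ ≡ e
∣∁p∣≡ {k} {e} A ∣A∣≡k k+e≡n = trans (∣∁p∣≡n∸∣p∣ A) (trans (cong₂ _∸_ (sym k+e≡n) ∣A∣≡k) (m+n∸m≡n k e))

∁-involutive : (A : Subset n) → ∁ (∁ A) ≡ A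
∁-involutive [] = refl
∁-involutive (true ∷ A) = cong (true ∷_) (∁-involutive A)
∁-involutive (false ∷ A) = cong (false ∷_) (∁-involutive A)

∣delete∣ : ∀ {A : Subset n} {x} → x ∈ A → ∣ A ∣ ≡ suc ∣ A [ x ]≔ outside ∣
∣delete∣ here = refl
∣delete∣ {A = true ∷ _} (there x∈A) = cong suc (∣delete∣ x∈A)
∣delete∣ {A = false ∷ _} (there x∈A) = ∣delete∣ x∈A

∣delete∩∣ : ∀ {A : Subset n} {x} (B : Subset n) → x ∈ A → x ∈ B → ∣ A ∩ B ∣ ≡ suc ∣ (A [ x ]≔ outside) ∩ B ∣
∣delete∩∣ (true ∷ B) here here = refl
∣delete∩∣ {A = true ∷ _} (true ∷ B) (there x∈A) (there x∈B) = cong suc (∣delete∩∣ B x∈A x∈B)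
∣delete∩∣ {A = true ∷ _} (false ∷ B) (there x∈A) (there x∈B) = ∣delete∩∣ B x∈A x∈B
∣delete∩∣ {A = false ∷ _} (_ ∷ B) (there x∈A) (there x∈B) = ∣delete∩∣ B x∈A x∈B

∣delete∩delete∣ : ∀ {A B : Subset n} {x} → x ∈ A → x ∈ B →
  ∣ A ∩ B ∣ ≡ suc ∣ (A [ x ]≔ outside) ∩ (B [ x ]≔ outside) ∣
∣delete∩delete∣ here here = refl
∣delete∩delete∣ {A = true ∷ _} {true ∷ B} (there x∈A) (there x∈B) = cong suc (∣delete∩delete∣ x∈A x∈B)
∣delete∩delete∣ {A = true ∷ _} {false ∷ B} (there x∈A) (there x∈B) = ∣delete∩delete∣ x∈A x∈B
∣delete∩delete∣ {A = false ∷ _} {_ ∷ B} (there x∈A) (there x∈B) = ∣delete∩delete∣ x∈A x∈B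

∣delete∩∣≤ : ∀ (A B : Subset n) x → ∣ (A [ x ]≔ outside) ∩ B ∣ ≤ ∣ A ∩ B ∣
∣delete∩∣≤ (true ∷ A) (true ∷ B) zero = n≤1+n _
∣delete∩∣≤ (true ∷ A) (false ∷ B) zero = ≤-refl
∣delete∩∣≤ (false ∷ A) (_ ∷ B) zero = ≤-refl
∣delete∩∣≤ (true ∷ A) (true ∷ B) (suc x) = s≤s (∣delete∩∣≤ A B x)
∣delete∩∣≤ (true ∷ A) (false ∷ B) (suc x) = ∣delete∩∣≤ A B x
∣delete∩∣≤ (false ∷ A) (_ ∷ B) (suc x) = ∣delete∩∣≤ A B x

∣delete∩insert∣≤ : ∀ (A B : Subset n) x → ∣ (A [ x ]≔ outside) ∩ (B [ x ]≔ inside) ∣ ≤ ∣ A ∩ B ∣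
∣delete∩insert∣≤ (true ∷ A) (true ∷ B) zero = n≤1+n _
∣delete∩insert∣≤ (true ∷ A) (false ∷ B) zero = ≤-refl
∣delete∩insert∣≤ (false ∷ A) (_ ∷ B) zero = ≤-refl
∣delete∩insert∣≤ (true ∷ A) (true ∷ B) (suc x) = s≤s (∣delete∩insert∣≤ A B x)
∣delete∩insert∣≤ (true ∷ A) (false ∷ B) (suc x) = ∣delete∩insert∣≤ A B x
∣delete∩insert∣≤ (false ∷ A) (_ ∷ B) (suc x) = ∣delete∩insert∣≤ A B x

∩-insert : ∀ (A B : Subset n) {x} → x ∉ A → A ∩ (B [ x ]≔ inside) ≡ A ∩ B
∩-insert (true ∷ A) (_ ∷ B) {zero} x∉A = contradiction here x∉A
∩-insert (false ∷ A) (_ ∷ B) {zero} x∉A = refl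
∩-insert (a ∷ A) (_ ∷ B) {suc x} x∉A = cong (_ ∷_) (∩-insert A B (x∉A ∘ there))

toggle-∉ : ∀ (A : Subset n) {x} → x ∉ A → A [ x ]%= not ≡ A [ x ]≔ inside
toggle-∉ (true ∷ A) {zero} x∉A = contradiction here x∉A
toggle-∉ (false ∷ A) {zero} x∉A = refl
toggle-∉ (_ ∷ A) {suc x} x∉A = cong (_ ∷_) (toggle-∉ A (x∉A ∘ there))

delete-insert : ∀ (A : Subset n) {x} → x ∉ A → (A [ x ]≔ inside) [ x ]≔ outside ≡ A
delete-insert (true ∷ A) {zero} x∉A = contradiction here x∉A
delete-insert (false ∷ A) {zero} x∉A = refl
delete-insert (_ ∷ A) {suc x} x∉A = cong (_ ∷_) (delete-insert A (x∉A ∘ there))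

x∈insert : ∀ (A : Subset n) x → x ∈ A [ x ]≔ inside
x∈insert (_ ∷ A) zero = here
x∈insert (_ ∷ A) (suc x) = there (x∈insert A x)

-- Counting the subsets that satisfy a decidable predicate.

-- Recursion on the first point makes the split into sets avoiding 0 and sets containing 0 hold by
-- definition, which is the split used by the induction on n.
# : {P : Pred (Subset n) 0ℓ} → Decidable P → ℕ
# {zero}  P? = if does (P? []) then 1 else 0
# {suc n} P? = # (P? ∘ (outside ∷_)) + # (P? ∘ (inside ∷_))

+-interchange : ∀ a b c d → (a + b) + (c + d) ≡ (a + c) + (b + d)
+-interchange = solve-∀

#-cover : (P? : Decidable P) (Q? : Decidable Q) (R? : Decidable R) →
  (∀ A → P A → Q A ⊎ R A) → # P? ≤ # Q? + # R?
#-cover {zero} P? Q? R? c with P? [] | Q? [] | R? []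
... | no _  | _     | _ = z≤n
... | yes _ | yes _ | _ = s≤s z≤n
... | yes _ | no _  | yes _ = ≤-refl
... | yes p | no ¬q | no ¬r = ⊥-elim ([ ¬q , ¬r ]′ (c [] p))
#-cover {suc n} P? Q? R? c = ≤-trans
  (+-mono-≤ (#-cover (P? ∘ (outside ∷_)) (Q? ∘ (outside ∷_)) (R? ∘ (outside ∷_)) (λ A → c (outside ∷ A)))
            (#-cover (P? ∘ (inside ∷_)) (Q? ∘ (inside ∷_)) (R? ∘ (inside ∷_)) (λ A → c (inside ∷ A))))
  (≤-reflexive (+-interchange (# (Q? ∘ (outside ∷_))) (# (R? ∘ (outside ∷_))) (# (Q? ∘ (inside ∷_))) _))

#-mono : (P? : Decidable P) (Q? : Decidable Q) → P ⊆ Q → # P? ≤ # Q?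
#-mono {zero} P? Q? P⊆Q with P? [] | Q? []
... | no _  | _     = z≤n
... | yes _ | yes _ = ≤-refl
... | yes p | no ¬q = contradiction (P⊆Q p) ¬q
#-mono {suc n} P? Q? P⊆Q = +-mono-≤
  (#-mono (P? ∘ (outside ∷_)) (Q? ∘ (outside ∷_)) P⊆Q)
  (#-mono (P? ∘ (inside ∷_)) (Q? ∘ (inside ∷_)) P⊆Q)

#-disjoint : (P? : Decidable P) (Q? : Decidable Q) (R? : Decidable R) →
  (∀ A → P A → ¬ Q A) → P ⊆ R → Q ⊆ R → # P? + # Q? ≤ # R?
#-disjoint {zero} P? Q? R? disj P⊆R Q⊆R with P? [] | Q? [] | R? []
... | yes p | yes q | _     = contradiction q (disj [] p)
... | yes p | no _  | yes _ = ≤-refl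
... | yes p | no _  | no ¬r = contradiction (P⊆R p) ¬r
... | no _  | yes q | yes _ = ≤-refl
... | no _  | yes q | no ¬r = contradiction (Q⊆R q) ¬r
... | no _  | no _  | _     = z≤n
#-disjoint {suc n} P? Q? R? disj P⊆R Q⊆R = ≤-trans
  (≤-reflexive (+-interchange (# (P? ∘ (outside ∷_))) (# (P? ∘ (inside ∷_))) (# (Q? ∘ (outside ∷_))) _))
  (+-mono-≤ (#-disjoint _ _ _ (λ A → disj (outside ∷ A)) P⊆R Q⊆R)
            (#-disjoint _ _ _ (λ A → disj (inside ∷ A)) P⊆R Q⊆R))

#-∁ : (P? : Decidable P) → # (P? ∘ ∁) ≡ # P?
#-∁ {zero} P? = refl
#-∁ {suc n} P? = trans (cong₂ _+_ (#-∁ (P? ∘ (inside ∷_))) (#-∁ (P? ∘ (outside ∷_))))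
  (+-comm (# (P? ∘ (inside ∷_))) _)

-- Toggling `x` is a bijection on subsets: at the first point it swaps the two halves of the count,
-- at a later one it acts inside each half.
#-toggle : ∀ x (P? : Decidable P) (Q? : Decidable Q) → (∀ A → P A → Q (A [ x ]%= not)) → # P? ≤ # Q?
#-toggle zero P? Q? f = ≤-trans
  (+-mono-≤ (#-mono _ (Q? ∘ (inside ∷_)) (f (outside ∷ _))) (#-mono _ (Q? ∘ (outside ∷_)) (f (inside ∷ _))))
  (≤-reflexive (+-comm (# (Q? ∘ (inside ∷_))) _))
#-toggle (suc x) P? Q? f = +-mono-≤ (#-toggle x _ _ (λ A → f (outside ∷ A))) (#-toggle x _ _ (λ A → f (inside ∷ A)))

inhabited⊎#≡0 : (P? : Decidable P) → (∃[ A ] P A) ⊎ # P? ≡ 0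
inhabited⊎#≡0 {zero} P? with P? []
... | yes p = inj₁ ([] , p)
... | no _  = inj₂ refl
inhabited⊎#≡0 {suc n} P? with inhabited⊎#≡0 (P? ∘ (outside ∷_))
... | inj₁ (A , p) = inj₁ (outside ∷ A , p)
... | inj₂ eq with inhabited⊎#≡0 (P? ∘ (inside ∷_))
...   | inj₁ (A , p) = inj₁ (inside ∷ A , p)
...   | inj₂ eq′ = inj₂ (cong₂ _+_ eq eq′)

1≤# : (P? : Decidable P) → ∃[ A ] P A → 1 ≤ # P?
1≤# {zero} P? ([] , p) with P? []
... | yes _ = ≤-refl
... | no ¬p = contradiction p ¬p
1≤# {suc n} P? (false ∷ A , p) = m≤n⇒m≤n+o _ (1≤# (P? ∘ (outside ∷_)) (A , p))
1≤# {suc n} P? (true ∷ A , p) = m≤n⇒m≤o+n _ (1≤# (P? ∘ (inside ∷_)) (A , p))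

#-unique : (P? : Decidable P) → (∀ A B → P A → P B → A ≡ B) → # P? ≤ 1
#-unique {zero} P? u with P? []
... | yes _ = ≤-refl
... | no _  = z≤n
#-unique {suc n} P? u with inhabited⊎#≡0 (P? ∘ (inside ∷_))
... | inj₂ eq = ≤-trans (≤-reflexive (trans (cong (# (P? ∘ (outside ∷_)) +_) eq) (+-identityʳ _)))
                  (#-unique (P? ∘ (outside ∷_)) (λ A B p q → ∷-injectiveʳ (u (outside ∷ A) (outside ∷ B) p q)))
... | inj₁ (B , q) with inhabited⊎#≡0 (P? ∘ (outside ∷_))
...   | inj₁ (A , p) = contradiction (u _ _ p q) λ ()
...   | inj₂ eq = ≤-trans (≤-reflexive (cong (_+ # (P? ∘ (inside ∷_))) eq))
                  (#-unique (P? ∘ (inside ∷_)) (λ A B p q → ∷-injectiveʳ (u (inside ∷ A) (inside ∷ B) p q)))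

-- Counting sets by their size and their intersection with a fixed set.

Profile : Set₁
Profile = ℕ → ℕ → Set

Decidable₂ : Profile → Set
Decidable₂ F = ∀ a t → Dec (F a t)

-- profileCount d e F? is the number of subsets X of a (d + e)-set for which F ∣X∣ ∣X∩D∣
-- holds, where D is any fixed d-subset.
profileCount : ∀ {F : Profile} → ℕ → ℕ → Decidable₂ F → ℕ
profileCount zero zero F? = if does (F? 0 0) then 1 else 0
profileCount zero (suc e) F? = profileCount zero e F? + profileCount zero e (λ a t → F? (suc a) t)
profileCount (suc d) e F? = profileCount d e F? + profileCount d e (λ a t → F? (suc a) (suc t))

-- The recursion uses up the points of `D` first; this splits off a point outside `D` while points
-- of `D` remain.
profileCount-suc : ∀ {F : Profile} d e (F? : Decidable₂ F) →
  profileCount d (suc e) F? ≡ profileCount d e F? + profileCount d e (λ a t → F? (suc a) t)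
profileCount-suc zero e F? = refl
profileCount-suc (suc d) e F? = trans
  (cong₂ _+_ (profileCount-suc d e F?) (profileCount-suc d e (λ a t → F? (suc a) (suc t))))
  (+-interchange (profileCount d e F?) _ _ _)

private
  variable
    F G : Profile

profileCount-mono : ∀ d e (F? : Decidable₂ F) (G? : Decidable₂ G) → (∀ a t → F a t → G a t) →
  profileCount d e F? ≤ profileCount d e G?
profileCount-mono zero zero F? G? F⊆G with F? 0 0 | G? 0 0
... | no _  | _     = z≤n
... | yes _ | yes _ = ≤-refl
... | yes p | no ¬q = contradiction (F⊆G 0 0 p) ¬q
profileCount-mono zero (suc e) F? G? F⊆G =
  +-mono-≤ (profileCount-mono zero e _ _ F⊆G) (profileCount-mono zero e _ _ (λ a → F⊆G (suc a)))
profileCount-mono (suc d) e F? G? F⊆G =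
  +-mono-≤ (profileCount-mono d e _ _ F⊆G) (profileCount-mono d e _ _ (λ a t → F⊆G (suc a) (suc t)))

-- A set with `a` points in `D` and `b` points outside exists and is counted only on the right.
profileCount-strict : ∀ {d e a b} (F? : Decidable₂ F) (G? : Decidable₂ G) → (∀ a t → F a t → G a t) →
  a ≤ d → b ≤ e → ¬ F (a + b) a → G (a + b) a → profileCount d e F? < profileCount d e G?
profileCount-strict {d = zero} {zero} F? G? F⊆G z≤n z≤n ¬f g with F? 0 0 | G? 0 0
... | yes f | _     = contradiction f ¬f
... | no _  | no ¬g = contradiction g ¬g
... | no _  | yes _ = ≤-refl
profileCount-strict {d = zero} {suc e} F? G? F⊆G z≤n z≤n ¬f g =
  +-mono-<-≤ (profileCount-strict {d = 0} {e} F? G? F⊆G z≤n z≤n ¬f g)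
    (profileCount-mono zero e _ _ (λ a → F⊆G (suc a)))
profileCount-strict {d = zero} {suc e} F? G? F⊆G z≤n (s≤s b≤e) ¬f g =
  +-mono-≤-< (profileCount-mono zero e F? G? F⊆G)
    (profileCount-strict {d = 0} {e} _ _ (λ a → F⊆G (suc a)) z≤n b≤e ¬f g)
profileCount-strict {d = suc d} {e} F? G? F⊆G z≤n b≤e ¬f g =
  +-mono-<-≤ (profileCount-strict {d = d} {e} F? G? F⊆G z≤n b≤e ¬f g)
    (profileCount-mono d e _ _ (λ a t → F⊆G (suc a) (suc t)))
profileCount-strict {d = suc d} {e} F? G? F⊆G (s≤s a≤d) b≤e ¬f g =
  +-mono-≤-< (profileCount-mono d e F? G? F⊆G)
    (profileCount-strict {d = d} {e} _ _ (λ a t → F⊆G (suc a) (suc t)) a≤d b≤e ¬f g)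

-- The profile is arbitrary so that the induction can absorb a chosen point by shifting its
-- arguments.
#-profile : ∀ (D : Subset n) (F? : Decidable₂ F) →
  # (λ X → F? ∣ X ∣ ∣ X ∩ D ∣) ≡ profileCount ∣ D ∣ ∣ ∁ D ∣ F?
#-profile [] F? = refl
#-profile (true ∷ D) F? = cong₂ _+_ (#-profile D F?) (#-profile D (λ a t → F? (suc a) (suc t)))
#-profile (false ∷ D) F? = trans
  (cong₂ _+_ (#-profile D F?) (#-profile D (λ a t → F? (suc a) t)))
  (sym (profileCount-suc ∣ D ∣ ∣ ∁ D ∣ F?))

AtLeast : ℕ → ℕ → Profile
AtLeast r s a t = a ≡ r × s ≤ t

atLeast? : ∀ r s → Decidable₂ (AtLeast r s)
atLeast? r s a t = (a ≟ r) ×-dec (s ≤? t)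

#-atLeast : ∀ {k e n} (D : Subset n) → ∣ D ∣ ≡ k → k + e ≡ n → ∀ r s →
  # (λ X → atLeast? r s ∣ X ∣ ∣ X ∩ D ∣) ≡ profileCount k e (atLeast? r s)
#-atLeast D ∣D∣≡k k+e≡n r s = trans (#-profile D (atLeast? r s))
  (cong₂ (λ d e → profileCount d e (atLeast? r s)) ∣D∣≡k (∣∁p∣≡ D ∣D∣≡k k+e≡n))

-- Cross-intersecting pairs and the shift from 0 to another point.

Meet : ℕ → (P Q : Pred (Subset n) 0ℓ) → Set
Meet s P Q = ∀ A B → P A → Q B → s ≤ ∣ A ∩ B ∣

record CrossUniform (k s : ℕ) (P Q : Pred (Subset n) 0ℓ) : Set where
  field
    sizeˡ : ∀ A → P A → ∣ A ∣ ≡ k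
    sizeʳ : ∀ B → Q B → ∣ B ∣ ≡ k
    meet  : Meet s P Q

open CrossUniform

-- Every set in P containing the point 0 but not the point suc x exchanges 0 for suc x,
-- unless the result is already in P.
Shift : Fin n → Pred (Subset (suc n)) 0ℓ → Pred (Subset (suc n)) 0ℓ
Shift x P (false ∷ A) = P (outside ∷ A) ⊎ (x ∈ A × P (inside ∷ A [ x ]≔ outside))
Shift x P (true ∷ A)  = P (inside ∷ A) × (x ∈ A ⊎ P (outside ∷ A [ x ]≔ inside))

shift? : ∀ {P : Pred (Subset (suc n)) 0ℓ} x → Decidable P → Decidable (Shift x P)
shift? x P? (false ∷ A) = P? (outside ∷ A) ⊎-dec ((x ∈? A) ×-dec P? (inside ∷ A [ x ]≔ outside))
shift? x P? (true ∷ A)  = P? (inside ∷ A) ×-dec ((x ∈? A) ⊎-dec P? (outside ∷ A [ x ]≔ inside))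

Stable : Fin n → Pred (Subset (suc n)) 0ℓ → Set
Stable x P = ∀ {A} → P (inside ∷ A) → x ∉ A → P (outside ∷ A [ x ]≔ inside)

-- A set that keeps 0 and misses `x` was kept because its exchange was already in `P`, and the shift
-- retains all members avoiding 0.
shift-stable : ∀ {P : Pred (Subset (suc n)) 0ℓ} x → Stable x (Shift x P)
shift-stable x (_ , inj₁ x∈A) x∉A = contradiction x∈A x∉A
shift-stable x (_ , inj₂ p)   _   = inj₁ p

-- A shift removes only sets containing 0 and adds only sets avoiding 0, so neither can break
-- stability at another point.
shift-preserves-stable : ∀ {P : Pred (Subset (suc n)) 0ℓ} x y → Stable y P → Stable y (Shift x P)
shift-preserves-stable x y stable (p , _) y∉A = inj₁ (stable p y∉A)

-- The exchange injects the lost sets into the gained ones. Adding `# gained?` to both sides lets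
-- the sets avoiding 0 and the sets containing 0 be compared separately.
#-shift : ∀ {P : Pred (Subset (suc n)) 0ℓ} x (P? : Decidable P) → # P? ≤ # (shift? x P?)
#-shift {n} {P} x P? = +-cancelʳ-≤ (# gained?) _ _ (begin
  (# P₀? + # P₁?) + # gained?  ≡⟨ l (# P₀?) (# P₁?) (# gained?) ⟩
  (# P₀? + # gained?) + # P₁?  ≤⟨ +-mono-≤ outside≤ inside≤ ⟩
  # S₀? + (# S₁? + # lost?)    ≤⟨ +-monoʳ-≤ (# S₀?) (+-monoʳ-≤ (# S₁?) lost≤gained) ⟩
  # S₀? + (# S₁? + # gained?)  ≡⟨ sym (+-assoc (# S₀?) (# S₁?) _) ⟩
  (# S₀? + # S₁?) + # gained?  ∎)
  where
  open ≤-Reasoning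

  l : ∀ a b c → (a + b) + c ≡ (a + c) + b
  l = solve-∀

  P₀? = P? ∘ (outside ∷_)
  P₁? = P? ∘ (inside ∷_)
  S₀? = shift? x P? ∘ (outside ∷_)
  S₁? = shift? x P? ∘ (inside ∷_)

  Gained Lost : Pred (Subset n) 0ℓ
  Gained A = ¬ P (outside ∷ A) × (x ∈ A × P (inside ∷ A [ x ]≔ outside))
  Lost A   = P (inside ∷ A) × (x ∉ A × ¬ P (outside ∷ A [ x ]≔ inside))

  gained? : Decidable Gained
  gained? A = ¬? (P? (outside ∷ A)) ×-dec ((x ∈? A) ×-dec P? (inside ∷ A [ x ]≔ outside))

  lost? : Decidable Lost
  lost? A = P? (inside ∷ A) ×-dec (¬? (x ∈? A) ×-dec ¬? (P? (outside ∷ A [ x ]≔ inside)))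

  outside≤ : # P₀? + # gained? ≤ # S₀?
  outside≤ = #-disjoint P₀? gained? S₀? (λ _ p g → proj₁ g p) inj₁ (inj₂ ∘ proj₂)

  inside≤ : # P₁? ≤ # S₁? + # lost?
  inside≤ = #-cover P₁? S₁? lost? cover
    where
    cover : ∀ A → P (inside ∷ A) → Shift x P (inside ∷ A) ⊎ Lost A
    cover A p with x ∈? A | P? (outside ∷ A [ x ]≔ inside)
    ... | yes x∈A | _      = inj₁ (p , inj₁ x∈A)
    ... | no _    | yes p′ = inj₁ (p , inj₂ p′)
    ... | no x∉A  | no ¬p′ = inj₂ (p , x∉A , ¬p′)

  lost≤gained : # lost? ≤ # gained?
  lost≤gained = #-toggle x lost? gained? λ A (p , x∉A , ¬p′) → subst Gained (sym (toggle-∉ A x∉A))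
    (¬p′ , x∈insert A x , subst (λ B → P (inside ∷ B)) (sym (delete-insert A x∉A)) p)

shift-size : ∀ {P : Pred (Subset (suc n)) 0ℓ} x → (∀ A → P A → ∣ A ∣ ≡ k) →
  ∀ A → Shift x P A → ∣ A ∣ ≡ k
shift-size x size (false ∷ A) (inj₁ p) = size _ p
shift-size x size (false ∷ A) (inj₂ (x∈A , p)) = trans (∣delete∣ x∈A) (size _ p)
shift-size x size (true ∷ A) (p , _) = size _ p

meet-sym : (P Q : Pred (Subset n) 0ℓ) → Meet s P Q → Meet s Q P
meet-sym {s = s} P Q meets B A q p = subst (λ C → s ≤ ∣ C ∣) (∩-comm A B) (meets A B p q)

-- Two gained sets trade the common point 0 for the common point `x`. The critical case is a gained
-- set against one that keeps 0: there the common point 0 is lost and must be made up for.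
shift-meet : ∀ {P Q : Pred (Subset (suc n)) 0ℓ} x → Meet s P Q → Meet s (Shift x P) (Shift x Q)
shift-meet {n} {s} {P} {Q} x meets = go
  where
  gained-meets-kept : ∀ {P Q} → Meet s P Q → ∀ A B → x ∈ A → P (inside ∷ A [ x ]≔ outside) →
    Shift x Q (inside ∷ B) → s ≤ ∣ A ∩ B ∣
  -- Here the common point `x` replaces the lost common point 0.
  gained-meets-kept meets A B x∈A p (q , inj₁ x∈B) =
    ≤-trans (meets _ (inside ∷ B) p q) (≤-reflexive (sym (∣delete∩∣ B x∈A x∈B)))
  -- Here the exchange of the kept set is in `Q`; it meets the original of the gained set neither in
  -- 0 nor in `x`, so these s common points all lie in `A ∩ B`.
  gained-meets-kept meets A B x∈A p (q , inj₂ q′) =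
    ≤-trans (meets (inside ∷ A [ x ]≔ outside) _ p q′) (∣delete∩insert∣≤ A B x)

  go : Meet s (Shift x P) (Shift x Q)
  go (false ∷ A) (false ∷ B) (inj₁ p) (inj₁ q) = meets _ _ p q
  go (false ∷ A) (false ∷ B) (inj₂ (x∈A , p)) (inj₁ q) =
    ≤-trans (meets _ (outside ∷ B) p q) (∣delete∩∣≤ A B x)
  go (false ∷ A) (false ∷ B) (inj₁ p) (inj₂ (x∈B , q)) = subst (λ C → s ≤ ∣ C ∣) (∩-comm B A)
    (≤-trans (meet-sym P Q meets _ (outside ∷ A) q p) (∣delete∩∣≤ B A x))
  go (false ∷ A) (false ∷ B) (inj₂ (x∈A , p)) (inj₂ (x∈B , q)) =
    ≤-trans (meets _ _ p q) (≤-reflexive (sym (∣delete∩delete∣ x∈A x∈B)))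
  go (false ∷ A) (true ∷ B) (inj₁ p) (q , _) = meets _ _ p q
  go (false ∷ A) (true ∷ B) (inj₂ (x∈A , p)) q = gained-meets-kept meets A B x∈A p q
  go (true ∷ A) (false ∷ B) (p , _) (inj₁ q) = meets _ _ p q
  go (true ∷ A) (false ∷ B) p (inj₂ (x∈B , q)) = subst (λ C → s ≤ ∣ C ∣) (∩-comm B A)
    (gained-meets-kept (meet-sym P Q meets) B A x∈B q p)
  go (true ∷ A) (true ∷ B) (p , _) (q , _) = meets _ _ p q

shift-crossUniform : ∀ {P Q : Pred (Subset (suc n)) 0ℓ} x → CrossUniform k s P Q →
  CrossUniform k s (Shift x P) (Shift x Q)
shift-crossUniform x cu = record
  { sizeˡ = shift-size x (sizeˡ cu)
  ; sizeʳ = shift-size x (sizeʳ cu)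
  ; meet  = shift-meet x (meet cu)
  }

-- Compression along a list of points; one pass suffices for stability.

Compress : List (Fin n) → Pred (Subset (suc n)) 0ℓ → Pred (Subset (suc n)) 0ℓ
Compress xs P = foldr Shift P xs

compress? : ∀ {P : Pred (Subset (suc n)) 0ℓ} xs → Decidable P → Decidable (Compress xs P)
compress? []       P? = P?
compress? (x ∷ xs) P? = shift? x (compress? xs P?)

compress-stable : ∀ (P : Pred (Subset (suc n)) 0ℓ) {x} xs → x ∈ˡ xs → Stable x (Compress xs P)
compress-stable P (x ∷ xs) (hereˡ refl) = shift-stable {P = Compress xs P} x
compress-stable P (x ∷ xs) (thereˡ x∈xs) =
  shift-preserves-stable {P = Compress xs P} x _ (compress-stable P xs x∈xs)

#-compress : ∀ {P : Pred (Subset (suc n)) 0ℓ} xs (P? : Decidable P) → # P? ≤ # (compress? xs P?)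
#-compress []       P? = ≤-refl
#-compress (x ∷ xs) P? = ≤-trans (#-compress xs P?) (#-shift x (compress? xs P?))

compress-crossUniform : ∀ {P Q : Pred (Subset (suc n)) 0ℓ} xs → CrossUniform k s P Q →
  CrossUniform k s (Compress xs P) (Compress xs Q)
compress-crossUniform []       cu = cu
compress-crossUniform (x ∷ xs) cu = shift-crossUniform x (compress-crossUniform xs cu)

-- The bound and its inductive step.

1≤#⇒inhabited : (P? : Decidable P) → 1 ≤ # P? → ∃[ A ] P A
1≤#⇒inhabited P? 1≤#P with inhabited⊎#≡0 P?
... | inj₁ inhabited = inhabited
... | inj₂ #P≡0 = contradiction #P≡0 (n>0⇒n≢0 1≤#P)

Bound : ℕ → ℕ → Set₁
Bound n s = ∀ {k e} {P Q : Pred (Subset n) 0ℓ} (P? : Decidable P) (Q? : Decidable Q) →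
  k + e ≡ n → s ≤ k → k < e + s → CrossUniform k s P Q → (∃[ A ] P A) → (∃[ B ] Q B) →
  # P? + # Q? ≤ suc (profileCount k e (atLeast? k s))

#≤profileCount : ∀ {k e r} (P? : Decidable P) (D : Subset n) → ∣ D ∣ ≡ k → k + e ≡ n →
  (∀ A → P A → AtLeast r s ∣ A ∣ ∣ A ∩ D ∣) → # P? ≤ profileCount k e (atLeast? r s)
#≤profileCount P? D ∣D∣≡k k+e≡n f =
  ≤-trans (#-mono P? _ (f _)) (≤-reflexive (#-atLeast D ∣D∣≡k k+e≡n _ _))

-- The extremal family is split at a point outside its fixed set, matching the split of `P` and `Q`
-- at 0. The sets avoiding 0 already use up the extra 1, so those containing 0 must be bounded by
-- `links` exactly.
bound-stable : ∀ {n k e s} {P Q : Pred (Subset (suc n)) 0ℓ} (P? : Decidable P) (Q? : Decidable Q) →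
  Bound n (suc s) → suc k + e ≡ n → s ≤ k → suc k < e + suc s → CrossUniform (suc k) (suc s) P Q →
  (∃[ A ] P A) → (∃[ B ] Q B) → (∀ x → Stable x P) → (∀ x → Stable x Q) →
  # P? + # Q? ≤ suc (profileCount (suc k) (suc e) (atLeast? (suc k) (suc s)))
bound-stable {n} {k} {e} {s} {P} {Q} P? Q? ih k+e≡n s≤k k<e+s cu neP neQ stableP stableQ = begin
  (# P₀? + # P₁?) + (# Q₀? + # Q₁?)
    ≡⟨ +-interchange (# P₀?) (# P₁?) (# Q₀?) (# Q₁?) ⟩
  (# P₀? + # Q₀?) + (# P₁? + # Q₁?)
    ≤⟨ +-mono-≤ (ih P₀? Q₀? k+e≡n (s≤s s≤k) k<e+s cu₀ neP₀ neQ₀) inside≤ ⟩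
  suc (profileCount (suc k) e (atLeast? (suc k) (suc s)) + links)
    ≡⟨ cong suc (sym (profileCount-suc (suc k) e (atLeast? (suc k) (suc s)))) ⟩
  suc (profileCount (suc k) (suc e) (atLeast? (suc k) (suc s))) ∎
  where
  open ≤-Reasoning

  P₀? = P? ∘ (outside ∷_)
  P₁? = P? ∘ (inside ∷_)
  Q₀? = Q? ∘ (outside ∷_)
  Q₁? = Q? ∘ (inside ∷_)

  links : ℕ
  links = profileCount (suc k) e (λ a t → atLeast? (suc k) (suc s) (suc a) t)

  cu₀ : CrossUniform (suc k) (suc s) (P ∘ (outside ∷_)) (Q ∘ (outside ∷_))
  cu₀ = record { sizeˡ = λ _ → sizeˡ cu _ ; sizeʳ = λ _ → sizeʳ cu _ ; meet = λ _ _ → meet cu _ _ }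

  size₁ˡ : ∀ A → P (inside ∷ A) → ∣ A ∣ ≡ k
  size₁ˡ A p = suc-injective (sizeˡ cu _ p)

  size₁ʳ : ∀ B → Q (inside ∷ B) → ∣ B ∣ ≡ k
  size₁ʳ B q = suc-injective (sizeʳ cu _ q)

  -- Two links meeting in only s - 1 points would leave some x uncovered, and then
  -- stability would exchange the common point 0 for x in one of the two sets.
  meet₁ : Meet (suc s) (P ∘ (inside ∷_)) (Q ∘ (inside ∷_))
  meet₁ A B p q =
    let x , x∉A , x∉B = common-nonmember A B room
    in subst (λ C → suc s ≤ ∣ C ∣) (∩-insert A B x∉A) (meet cu (inside ∷ A) _ p (stableQ x q x∉B))
    where
    room : ∣ A ∣ + ∣ B ∣ < n + ∣ A ∩ B ∣
    room = begin-strict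
      ∣ A ∣ + ∣ B ∣            ≡⟨ cong₂ _+_ (size₁ˡ A p) (size₁ʳ B q) ⟩
      k + k                    ≤⟨ +-monoʳ-≤ k (n≤1+n k) ⟩
      k + suc k                <⟨ +-monoʳ-< k k<e+s ⟩
      -- The two members share 0 as well, so the links share at least `s` points.
      k + (e + suc s)          ≤⟨ +-monoʳ-≤ k (+-monoʳ-≤ e (meet cu _ _ p q)) ⟩
      k + (e + suc ∣ A ∩ B ∣)  ≡⟨ l k e (∣ A ∩ B ∣) ⟩
      suc k + e + ∣ A ∩ B ∣    ≡⟨ cong (_+ ∣ A ∩ B ∣) k+e≡n ⟩
      n + ∣ A ∩ B ∣            ∎
      where
      l : ∀ k e t → k + (e + suc t) ≡ suc k + e + t
      l = solve-∀

  cu₁ : CrossUniform k (suc s) (P ∘ (inside ∷_)) (Q ∘ (inside ∷_))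
  cu₁ = record { sizeˡ = size₁ˡ ; sizeʳ = size₁ʳ ; meet = meet₁ }

  -- The link of a member containing 0 has k < n points, so it misses some `x`, and stability
  -- exchanges 0 for `x`.
  inhabited₀ : ∀ {R : Pred (Subset (suc n)) 0ℓ} → (∀ A → R A → ∣ A ∣ ≡ suc k) →
    (∀ x → Stable x R) → ∃[ A ] R A → ∃[ A ] R (outside ∷ A)
  inhabited₀ size stable (false ∷ A , r) = A , r
  inhabited₀ size stable (true ∷ A , r) =
    let x , x∉A , _ = common-nonmember A A room in A [ x ]≔ inside , stable x r x∉A
    where
    ∣A∣≡k = suc-injective (size _ r)
    room : ∣ A ∣ + ∣ A ∣ < n + ∣ A ∩ A ∣
    room = begin-strict
      ∣ A ∣ + ∣ A ∣    ≡⟨ cong (_+ ∣ A ∣) ∣A∣≡k ⟩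
      k + ∣ A ∣        <⟨ +-monoˡ-< (∣ A ∣) (≤-trans (m≤m+n (suc k) e) (≤-reflexive k+e≡n)) ⟩
      n + ∣ A ∣        ≡⟨ cong (λ C → n + ∣ C ∣) (sym (∩-idem A)) ⟩
      n + ∣ A ∩ A ∣    ∎

  neP₀ = inhabited₀ (sizeˡ cu) stableP neP
  neQ₀ = inhabited₀ (sizeʳ cu) stableQ neQ

  atLeast≤links : profileCount (suc k) e (atLeast? k (suc s)) ≤ links
  atLeast≤links = profileCount-mono (suc k) e _ _ λ { _ _ (refl , s≤t) → refl , s≤t }

  -- The left side is the inductive bound for the links without its extra 1; strictness absorbs that
  -- 1. On the right the fixed set has one more point, y say.
  atLeast<links : suc s ≤ k → profileCount k (suc e) (atLeast? k (suc s)) < links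
  atLeast<links s<k = begin-strict
    profileCount k (suc e) (atLeast? k (suc s))
      ≡⟨ profileCount-suc k e (atLeast? k (suc s)) ⟩
    profileCount k e (atLeast? k (suc s)) + profileCount k e (λ a t → atLeast? k (suc s) (suc a) t)
      <⟨ +-mono-≤-< (profileCount-mono k e _ _ λ { _ _ (refl , s≤t) → refl , s≤t })
           -- The witness consists of y, s points of the old fixed set and k - s - 1 points
           -- elsewhere: it reaches s + 1 common points only by counting y.
           (profileCount-strict {d = k} {e} {s} {k ∸ suc s} _ _
             (λ { _ _ (a≡ , s≤t) → cong suc a≡ , m≤n⇒m≤1+n s≤t })
             s≤k
             (m≤n+o⇒m∸n≤o k (suc s) (≤-trans (n≤1+n k) (≤-trans (<⇒≤ k<e+s) (≤-reflexive (+-comm e (suc s))))))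
             (1+n≰n ∘ proj₂)
             (cong suc (m+[n∸m]≡n s<k) , ≤-refl)) ⟩
    links ∎

  inside≤ : # P₁? + # Q₁? ≤ links
  inside≤ with inhabited⊎#≡0 P₁? | inhabited⊎#≡0 Q₁?
  -- A member `A₀` of `P` avoiding 0 becomes the fixed set: since 0 is not in it, each link of `Q`
  -- itself meets it in at least `suc s` points.
  ... | inj₂ P₁≡0 | _ = begin
    # P₁? + # Q₁?  ≡⟨ cong (_+ # Q₁?) P₁≡0 ⟩
    # Q₁?          ≤⟨ #≤profileCount Q₁? A₀ (sizeˡ cu _ p₀) k+e≡n
                        (λ B q → size₁ʳ B q , meet-sym P Q (meet cu) (inside ∷ B) (outside ∷ A₀) q p₀) ⟩
    profileCount (suc k) e (atLeast? k (suc s)) ≤⟨ atLeast≤links ⟩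
    links          ∎
    where
    A₀ = proj₁ neP₀
    p₀ = proj₂ neP₀
  ... | inj₁ _ | inj₂ Q₁≡0 = begin
    # P₁? + # Q₁?  ≡⟨ trans (cong (# P₁? +_) Q₁≡0) (+-identityʳ _) ⟩
    # P₁?          ≤⟨ #≤profileCount P₁? B₀ (sizeʳ cu _ q₀) k+e≡n
                        (λ A p → size₁ˡ A p , meet cu (inside ∷ A) (outside ∷ B₀) p q₀) ⟩
    profileCount (suc k) e (atLeast? k (suc s)) ≤⟨ atLeast≤links ⟩
    links          ∎
    where
    B₀ = proj₁ neQ₀
    q₀ = proj₂ neQ₀
  ... | inj₁ (A , p) | inj₁ (B , q) = ≤-trans
    (ih P₁? Q₁? (trans (+-suc k e) k+e≡n) s<k (≤-trans (n≤1+n _) (≤-trans k<e+s (n≤1+n _))) cu₁ (A , p) (B , q))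
    (atLeast<links s<k)
    where
    s<k : suc s ≤ k
    s<k = ≤-trans (meet₁ A B p q) (≤-trans (∣p∩q∣≤∣p∣ A B) (≤-reflexive (size₁ˡ A p)))

-- The hypothesis is stronger by one than `k < e + s`; this pays for deleting 0, which lowers `e` by
-- one for the sets avoiding 0.
bound-step : ∀ {n k e s} {P Q : Pred (Subset (suc n)) 0ℓ} (P? : Decidable P) (Q? : Decidable Q) →
  Bound n s → k + e ≡ suc n → 1 ≤ s → s ≤ k → suc k < e + s → CrossUniform k s P Q →
  (∃[ A ] P A) → (∃[ B ] Q B) → # P? + # Q? ≤ suc (profileCount k e (atLeast? k s))
bound-step {e = zero} P? Q? ih k+e≡ 1≤s s≤k k<e+s = contradiction (≤-trans (n≤1+n _) k<e+s) (≤⇒≯ s≤k)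
bound-step {n} {suc k} {suc e} {suc s} P? Q? ih k+e≡ (s≤s z≤n) (s≤s s≤k) k<e+s cu neP neQ = ≤-trans
  (+-mono-≤ (#-compress xs P?) (#-compress xs Q?))
  (bound-stable (compress? xs P?) (compress? xs Q?) ih
    (trans (sym (+-suc k e)) (suc-injective k+e≡)) s≤k (s≤s⁻¹ k<e+s) (compress-crossUniform xs cu)
    (compress-inhabited P? neP) (compress-inhabited Q? neQ)
    (λ x → compress-stable _ xs (∈-allFin x)) (λ x → compress-stable _ xs (∈-allFin x)))
  where
  xs : List (Fin n)
  xs = allFin n

  compress-inhabited : ∀ {R} (R? : Decidable R) → ∃[ A ] R A → ∃[ A ] Compress xs R A
  compress-inhabited R? ne = 1≤#⇒inhabited (compress? xs R?) (≤-trans (1≤# R? ne) (#-compress xs R?))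

-- Boundary cases: complementary pairs and duality.

-- `P` and the complements of members of `Q` are disjoint families of k-sets, so the sum is at most
-- the number of all k-sets. Of these only the complement of `B` fails to meet `B`, which accounts
-- for the 1.
bound-matching : ∀ {n k} {P Q : Pred (Subset n) 0ℓ} (P? : Decidable P) (Q? : Decidable Q) →
  k + k ≡ n → CrossUniform k 1 P Q → ∃[ B ] Q B → # P? + # Q? ≤ suc (profileCount k k (atLeast? k 1))
bound-matching {n} {k} {P} {Q} P? Q? k+k≡n cu (B , q) = begin
  # P? + # Q?                                      ≡⟨ cong (# P? +_) (sym (#-∁ Q?)) ⟩
  # P? + # (Q? ∘ ∁)                                ≤⟨ #-disjoint P? (Q? ∘ ∁) size? disjoint (sizeˡ cu _) (sizeQ∁ _) ⟩
  # size?                                          ≤⟨ #-cover size? _ disjoint? cover ⟩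
  # (λ X → atLeast? k 1 ∣ X ∣ ∣ X ∩ B ∣) + # disjoint?
    ≤⟨ +-mono-≤ (≤-reflexive (#-atLeast B (sizeʳ cu B q) k+k≡n k 1)) (#-unique disjoint? unique′) ⟩
  profileCount k k (atLeast? k 1) + 1              ≡⟨ +-comm _ 1 ⟩
  suc (profileCount k k (atLeast? k 1))            ∎
  where
  open ≤-Reasoning

  size? : Decidable (λ (X : Subset n) → ∣ X ∣ ≡ k)
  size? X = ∣ X ∣ ≟ k

  Disjoint : Pred (Subset n) 0ℓ
  Disjoint X = ∣ X ∣ ≡ k × ∣ X ∩ B ∣ ≡ 0

  disjoint? : Decidable Disjoint
  disjoint? X = size? X ×-dec (∣ X ∩ B ∣ ≟ 0)

  disjoint : ∀ A → P A → ¬ Q (∁ A)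
  disjoint A p q = contradiction (meet cu _ _ p q) (<⇒≱ (s≤s (≤-reflexive (∣p∩∁p∣≡0 A))))

  sizeQ∁ : ∀ A → Q (∁ A) → ∣ A ∣ ≡ k
  sizeQ∁ A q = trans (cong ∣_∣ (sym (∁-involutive A))) (∣∁p∣≡ (∁ A) (sizeʳ cu _ q) k+k≡n)

  cover : ∀ X → ∣ X ∣ ≡ k → AtLeast k 1 ∣ X ∣ ∣ X ∩ B ∣ ⊎ Disjoint X
  cover X ∣X∣≡k with ∣ X ∩ B ∣ ≟ 0
  ... | yes eq = inj₂ (∣X∣≡k , eq)
  ... | no neq = inj₁ (∣X∣≡k , n≢0⇒n>0 neq)

  is-∁ : ∀ {X} → Disjoint X → X ≡ ∁ B
  is-∁ {X} (∣X∣≡k , ∣X∩B∣≡0) = ∁-unique X B (+-cancelʳ-≡ (∣ X ∣ + ∣ B ∣) _ 0 eq) ∣X∩B∣≡0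
    where
    eq : ∣ ∁ X ∩ ∁ B ∣ + (∣ X ∣ + ∣ B ∣) ≡ ∣ X ∣ + ∣ B ∣
    eq = trans (inclusion-exclusion X B) (trans (cong (n +_) ∣X∩B∣≡0) (trans (+-identityʳ n)
           (trans (sym k+k≡n) (sym (cong₂ _+_ ∣X∣≡k (sizeʳ cu B q))))))

  unique′ : ∀ X Y → Disjoint X → Disjoint Y → X ≡ Y
  unique′ X Y dX dY = trans (is-∁ dX) (sym (is-∁ dY))

-- Inclusion-exclusion for two e-sets: complementing both changes the intersection size by k - e.
∣∁p∩∁q∣+e≡ : ∀ {n k e} (A B : Subset n) → k + e ≡ n → ∣ A ∣ ≡ e → ∣ B ∣ ≡ e →
  ∣ ∁ A ∩ ∁ B ∣ + e ≡ k + ∣ A ∩ B ∣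
∣∁p∩∁q∣+e≡ {n} {k} {e} A B k+e≡n ∣A∣≡e ∣B∣≡e = +-cancelʳ-≡ e _ _ (trans (+-assoc _ e e)
  (trans (cong (∣ ∁ A ∩ ∁ B ∣ +_) (sym (cong₂ _+_ ∣A∣≡e ∣B∣≡e)))
  (trans (inclusion-exclusion A B) (trans (cong (_+ ∣ A ∩ B ∣) (sym k+e≡n)) (l k e (∣ A ∩ B ∣))))))
  where
  l : ∀ k e t → k + e + t ≡ k + t + e
  l = solve-∀

-- When n = 2k - s + 1, two k-sets meet in at least s points exactly when their
-- complements meet.
bound-dual : ∀ {n k e s} {P Q : Pred (Subset n) 0ℓ} (P? : Decidable P) (Q? : Decidable Q) →
  Bound n 1 → k + e ≡ n → 1 ≤ s → s ≤ k → e + s ≡ suc k → CrossUniform k s P Q →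
  (∃[ A ] P A) → (∃[ B ] Q B) → # P? + # Q? ≤ suc (profileCount k e (atLeast? k s))
bound-dual {n} {k} {e} {s} {P} {Q} P? Q? bound₁ k+e≡n 1≤s s≤k e+s≡1+k cu (A₀ , p₀) (B₀ , q₀) = begin
  # P? + # Q?                            ≡⟨ sym (cong₂ _+_ (#-∁ P?) (#-∁ Q?)) ⟩
  # (P? ∘ ∁) + # (Q? ∘ ∁)                ≤⟨ bound₁ (P? ∘ ∁) (Q? ∘ ∁) e+k≡n 1≤e e<k+1 cu∁
                                              (∁ A₀ , subst P (sym (∁-involutive A₀)) p₀)
                                              (∁ B₀ , subst Q (sym (∁-involutive B₀)) q₀) ⟩
  -- The profile count is the same for every fixed set of size e, so the complement of `A₀` may be
  -- taken; complementing leads back to k-sets meeting `A₀` in at least `s` points.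
  suc (profileCount e k (atLeast? e 1))  ≤⟨ s≤s (≤-trans (≤-reflexive (sym profile∁))
                                              (#≤profileCount _ A₀ (sizeˡ cu _ p₀) k+e≡n complement)) ⟩
  suc (profileCount k e (atLeast? k s))  ∎
  where
  open ≤-Reasoning

  e+k≡n : e + k ≡ n
  e+k≡n = trans (+-comm e k) k+e≡n

  1≤e : 1 ≤ e
  1≤e = +-cancelʳ-≤ s 1 e (≤-trans (s≤s s≤k) (≤-reflexive (sym e+s≡1+k)))

  e<k+1 : e < k + 1
  e<k+1 = begin-strict
    e      <⟨ m<m+n e 1≤s ⟩
    e + s  ≡⟨ e+s≡1+k ⟩
    1 + k  ≡⟨ +-comm 1 k ⟩
    k + 1  ∎

  size∁ : ∀ A → ∣ ∁ A ∣ ≡ k → ∣ A ∣ ≡ e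
  size∁ A ∣∁A∣≡k = trans (cong ∣_∣ (sym (∁-involutive A))) (∣∁p∣≡ (∁ A) ∣∁A∣≡k k+e≡n)

  s≤⇒1≤ : ∀ {i j} → i + e ≡ k + j → s ≤ i → 1 ≤ j
  s≤⇒1≤ {i} {j} eq s≤i = +-cancelˡ-≤ k 1 j (begin
    k + 1  ≡⟨ trans (+-comm k 1) (sym e+s≡1+k) ⟩
    e + s  ≤⟨ +-monoʳ-≤ e s≤i ⟩
    e + i  ≡⟨ trans (+-comm e i) eq ⟩
    k + j  ∎)

  1≤⇒s≤ : ∀ {i j} → i + e ≡ k + j → 1 ≤ j → s ≤ i
  1≤⇒s≤ {i} {j} eq 1≤j = +-cancelˡ-≤ e s i (begin
    e + s  ≡⟨ trans e+s≡1+k (+-comm 1 k) ⟩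
    k + 1  ≤⟨ +-monoʳ-≤ k 1≤j ⟩
    k + j  ≡⟨ trans (sym eq) (+-comm i e) ⟩
    e + i  ∎)

  cu∁ : CrossUniform e 1 (P ∘ ∁) (Q ∘ ∁)
  cu∁ = record
    { sizeˡ = λ A p → size∁ A (sizeˡ cu _ p)
    ; sizeʳ = λ B q → size∁ B (sizeʳ cu _ q)
    ; meet  = λ A B p q →
        s≤⇒1≤ (∣∁p∩∁q∣+e≡ A B k+e≡n (size∁ A (sizeˡ cu _ p)) (size∁ B (sizeʳ cu _ q))) (meet cu _ _ p q)
    }

  D : Subset n
  D = ∁ A₀

  ∣D∣≡e : ∣ D ∣ ≡ e
  ∣D∣≡e = ∣∁p∣≡ A₀ (sizeˡ cu A₀ p₀) k+e≡n

  profile∁ : # (λ X → atLeast? e 1 ∣ ∁ X ∣ ∣ ∁ X ∩ D ∣) ≡ profileCount e k (atLeast? e 1)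
  profile∁ = trans (#-∁ (λ X → atLeast? e 1 ∣ X ∣ ∣ X ∩ D ∣)) (#-atLeast D ∣D∣≡e e+k≡n e 1)

  complement : ∀ X → AtLeast e 1 ∣ ∁ X ∣ ∣ ∁ X ∩ D ∣ → AtLeast k s ∣ X ∣ ∣ X ∩ A₀ ∣
  complement X (∣∁X∣≡e , 1≤) =
    trans (cong ∣_∣ (sym (∁-involutive X))) (∣∁p∣≡ (∁ X) ∣∁X∣≡e e+k≡n) ,
    subst (λ C → s ≤ ∣ C ∣) (cong₂ _∩_ (∁-involutive X) (∁-involutive A₀))
      (1≤⇒s≤ (∣∁p∩∁q∣+e≡ (∁ X) D k+e≡n ∣∁X∣≡e ∣D∣≡e) 1≤)

-- The induction on the size of the ground set.

bound : ∀ n s → 1 ≤ s → Bound n s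
bound zero s 1≤s {k} P? Q? k+e≡0 s≤k =
  contradiction (≤-trans 1≤s s≤k) (<⇒≱ (s≤s (≤-reflexive (m+n≡0⇒m≡0 k k+e≡0))))
bound (suc n) s 1≤s {k} {e} P? Q? k+e≡ s≤k k<e+s cu neP neQ with e + s ≟ suc k
... | yes e+s≡1+k = bound-dual P? Q? bound₁ k+e≡ 1≤s s≤k e+s≡1+k cu neP neQ
  where
  -- Duality stays on the same ground set, but there is no circle: for s = 1 the boundary is k = e,
  -- which is the matching case, and otherwise the step descends to n.
  bound₁ : Bound (suc n) 1
  bound₁ {k} {e} P? Q? k+e≡ 1≤k k<e+1 cu neP neQ with k ≟ e
  ... | yes refl = bound-matching P? Q? k+e≡ cu neQ
  ... | no k≢e = bound-step P? Q? (bound n 1 ≤-refl) k+e≡ ≤-refl 1≤k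
    (≤∧≢⇒< k<e+1 λ 1+k≡e+1 → k≢e (suc-injective (trans 1+k≡e+1 (+-comm e 1)))) cu neP neQ
... | no e+s≢1+k = bound-step P? Q? (bound n s 1≤s) k+e≡ 1≤s s≤k (≤∧≢⇒< k<e+s (e+s≢1+k ∘ sym)) cu neP neQ

-- From families as lists to counts, and the theorem.

_≟ˢ_ : DecidableEquality (Subset n)
_≟ˢ_ = ≡-dec _≟ᵇ_

-- The head counts once, and by uniqueness the tail satisfies `P` with the head excluded.
length≤# : ∀ {xs : List (Subset n)} → Unique xs → (P? : Decidable P) → (∀ {A} → A ∈ˡ xs → P A) → length xs ≤ # P?
length≤# [] P? f = z≤n
length≤# {n} {P = P} {x ∷ xs} (x∉xs ∷ uniq) P? f = ≤-trans
  (+-mono-≤ (1≤# (x ≟ˢ_) (x , refl)) (length≤# uniq rest? λ A∈xs → f (thereˡ A∈xs) , All.lookup x∉xs A∈xs))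
  (#-disjoint (x ≟ˢ_) rest? P? (λ { _ x≡A (_ , x≢A) → x≢A x≡A }) (λ { refl → f (hereˡ refl) }) proj₁)
  where
  rest? : Decidable (λ A → P A × ¬ x ≡ A)
  rest? A = P? A ×-dec ¬? (x ≟ˢ A)

length-filter-map : ∀ {A B : Set} {S : Pred B 0ℓ} (S? : Decidable S) (f : A → B) xs →
  length (filter S? (map f xs)) ≡ length (filter (S? ∘ f) xs)
length-filter-map S? f [] = refl
length-filter-map S? f (x ∷ xs) with does (S? (f x))
... | true  = cong suc (length-filter-map S? f xs)
... | false = length-filter-map S? f xs

length-filter-subsets : ∀ n {P : Pred (Subset n) 0ℓ} (P? : Decidable P) → length (filter P? (subsets n)) ≡ # P?
length-filter-subsets zero P? with does (P? [])
... | true  = refl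
... | false = refl
length-filter-subsets (suc n) P? =
  trans (cong length (filter-++ P? (map (outside ∷_) (subsets n)) (map (inside ∷_) (subsets n))))
  (trans (length-++ (filter P? (map (outside ∷_) (subsets n))))
  (cong₂ _+_ (half outside) (half inside)))
  where
  half : ∀ b → length (filter P? (map (b ∷_) (subsets n))) ≡ # (P? ∘ (b ∷_))
  half b = trans (length-filter-map P? (b ∷_) (subsets n)) (length-filter-subsets n (P? ∘ (b ∷_)))

∣initial∣ : ∀ {n k} → k ≤ n → ∣ initial {n} k ∣ ≡ k
∣initial∣ {zero} z≤n = refl
∣initial∣ {suc n} z≤n = ∣initial∣ {n} z≤n
∣initial∣ {suc n} (s≤s k≤n) = cong suc (∣initial∣ k≤n)

card-familyC : ∀ {n k e} s → k + e ≡ n → card (familyC n k s) ≡ profileCount k e (atLeast? k s)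
card-familyC {n} {k} {e} s k+e≡n = trans (length-filter-subsets n (inC? k s))
  (#-atLeast (initial k) (∣initial∣ (subst (k ≤_) k+e≡n (m≤m+n k e))) k+e≡n k s)

theorem3 : ∀ (n k s : ℕ) → 1 ≤ s → s < k → 2 * k ∸ s < n →
    IsMaximum
    (λ v → ∃[ 𝒜 ] ∃[ ℬ ]
    (Uniform {n} k 𝒜 × Uniform {n} k ℬ × NonEmpty 𝒜 × NonEmpty ℬ
    × CrossIntersecting s 𝒜 ℬ × v ≡ card 𝒜 + card ℬ))
    (card (familyC n k s) + 1)
theorem3 n k s 1≤s s<k 2k∸s<n = attained , upper
  where
  2k<n+s : k + k < n + s
  2k<n+s = begin-strict
    k + k            ≡⟨ cong (k +_) (sym (+-identityʳ k)) ⟩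
    2 * k            ≤⟨ m≤n+m∸n (2 * k) s ⟩
    s + (2 * k ∸ s)  <⟨ +-monoʳ-< s 2k∸s<n ⟩
    s + n            ≡⟨ +-comm s n ⟩
    n + s            ∎
    where open ≤-Reasoning

  k≤n : k ≤ n
  -- Since s < k, the inequality 2k < n + s gives 2k ≤ n + k.
  k≤n = +-cancelʳ-≤ k k n (<⇒≤ (≤-trans 2k<n+s (+-monoʳ-≤ n (<⇒≤ s<k))))

  e : ℕ
  e = n ∸ k

  k+e≡n : k + e ≡ n
  k+e≡n = m+[n∸m]≡n k≤n

  k<e+s : k < e + s
  k<e+s = +-cancelˡ-< k k (e + s)
    (subst (k + k <_) (trans (cong (_+ s) (sym k+e≡n)) (+-assoc k e s)) 2k<n+s)

  D : Subset n
  D = initial k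

  inC⇔ : ∀ {C} → C ∈ᶠ familyC n k s → InC k s C
  inC⇔ = Equivalence.to (∈-familyC k s _)

  singleton : Family n
  singleton = record { members = D ∷ [] ; unique = All.[] ∷ [] }

  D∈C : D ∈ᶠ familyC n k s
  D∈C = Equivalence.from (∈-familyC k s D)
    (∣initial∣ k≤n , subst (s ≤_) (sym (trans (cong ∣_∣ (∩-idem D)) (∣initial∣ k≤n))) (<⇒≤ s<k))

  -- The maximum is attained by the family C paired with the single set [k].
  attained = familyC n k s , singleton ,
    (λ _ → proj₁ ∘ inC⇔) , (λ { _ (hereˡ refl) → ∣initial∣ k≤n }) ,
    (D , D∈C) , (D , hereˡ refl) ,
    (λ { _ _ C∈ (hereˡ refl) → proj₂ (inC⇔ C∈) }) , refl

  upper : ∀ v → _ → v ≤ card (familyC n k s) + 1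
  upper _ (𝒜 , ℬ , uniform𝒜 , uniformℬ , ne𝒜 , neℬ , cross , refl) = begin
    card 𝒜 + card ℬ                        ≤⟨ +-mono-≤ (length≤# (unique 𝒜) 𝒜? id) (length≤# (unique ℬ) ℬ? id) ⟩
    # 𝒜? + # ℬ?                            ≤⟨ bound n s 1≤s 𝒜? ℬ? k+e≡n (<⇒≤ s<k) k<e+s cu ne𝒜 neℬ ⟩
    suc (profileCount k e (atLeast? k s))  ≡⟨ cong suc (sym (card-familyC s k+e≡n)) ⟩
    suc (card (familyC n k s))             ≡⟨ +-comm 1 _ ⟩
    card (familyC n k s) + 1               ∎
    where
    open ≤-Reasoning

    𝒜? : Decidable (_∈ᶠ 𝒜)
    𝒜? A = any? (A ≟ˢ_) (members 𝒜)

    ℬ? : Decidable (_∈ᶠ ℬ)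
    ℬ? B = any? (B ≟ˢ_) (members ℬ)

    cu : CrossUniform k s (_∈ᶠ 𝒜) (_∈ᶠ ℬ)
    cu = record { sizeˡ = uniform𝒜 ; sizeʳ = uniformℬ ; meet = cross }
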